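{- There exists a string family on which $\ell = \Omega(r\log n/\log\log n)$. That is, there is an infinite set $\mathcal{F}$ of strings such that $\ell(w)=\Omega\big(r(w)\log n/\log\log n\big)$ for $w\in\mathcal{F}$, where $n=|w|$.
   Context: A string family is an infinite set of finite strings of unbounded length; asymptotic notation on a family refers to strings $w$ of the family with $n=|w|\to\infty$ (with constants uniform over the family). $w[i:j]$ denotes the substring of $w$ from position $i$ to position $j$ (positions start at 1). L-systems: an L-system is a tuple $(\Sigma,\varphi,\tau,s,d,n)$, where $\Sigma$ is a finite alphabet, $\varphi:\Sigma^*\to\Sigma^*$ is a non-erasing monoid endomorphism (each rule $a\to\varphi(a)$, $a\in\Sigma$, has $|\varphi(a)|\ge 1$), $\tau:\Sigma^*\to\Sigma^*$ is a coding (a morphism with $|\tau(a)|=1$ for all $a\in\Sigma$), $s\in\Sigma^+$ is the axiom, and $d\ge 0$, $n\ge 1$ are integers. It generates the unique string $\tau(\varphi^d(s))[1:n]$ of length $n$. It is always assumed that $d=n^{O(1)}$ and $|\Sigma|=n^{O(1)}$ (each value fits in an $O(\log n)$-bit word). The size of the L-system is $\sum_{a\in\Sigma}|\varphi(a)|+|s|+|\Sigma|+2$. The measure $\ell(w)$ is the size of the smallest L-system generating $w$. Burrows-Wheeler transform: $BWT(w)$ is the string obtained by sorting all $|w|$ rotations of $w$ lexicographically and concatenating their last symbols in that order. $r(w)$ is the number of maximal runs of equal symbols in $BWT(w)$. -}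

module Defs where

open import Data.Fin.Base using (Fin)
open import Data.List.Base
  using (List; _++_; allFin; concatMap; derun; drop; last; length; map; mapMaybe; take; upTo)
open import Data.List.NonEmpty.Base as List⁺ using (List⁺)
open import Data.List.Sort.Base using (module SortingAlgorithm)
open import Data.List.Sort.MergeSort using (mergeSort)
import Data.List.Relation.Binary.Lex.NonStrict as Lex
open import Data.Nat.Base using (ℕ; _+_; _*_; _^_; _≤_)
open import Data.Nat.GeneralisedArithmetic using (fold)
open import Data.Nat.ListAction using (sum)
open import Data.Nat.Logarithm using (⌊log₂_⌋)
open import Data.Nat.Properties using (_≟_; ≤-decTotalOrder)
open import Data.Product.Base using (Σ-syntax; ∃-syntax; _×_)
open import Function.Definitions using (Injective)
open import Level using (0ℓ)
open import Relation.Binary.Bundles using (DecTotalOrder)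
open import Relation.Binary.PropositionalEquality.Core using (_≡_)
open import Relation.Unary using (Pred; _∈_)

-- Strings are over the ordered alphabet ℕ.
String : Set
String = List ℕ

------------------------------------------------------------------------
-- Burrows-Wheeler transform

lexOrder : DecTotalOrder 0ℓ 0ℓ 0ℓ
lexOrder = Lex.≤-decTotalOrder ≤-decTotalOrder

open SortingAlgorithm (mergeSort lexOrder) using () renaming (sort to lexSort)

rotations : String → List String
rotations w = map (λ i → drop i w ++ take i w) (upTo (length w))

BWT : String → String
BWT w = mapMaybe last (lexSort (rotations w))

-- `derun` keeps exactly one symbol of each maximal run.
runs : String → ℕ
runs w = length (derun _≟_ w)

r : String → ℕ
r w = runs (BWT w)

------------------------------------------------------------------------
-- L-systems

-- The alphabet Σ is the finite set of symbols { symbol a | a : Fin σ } ⊂ ℕ,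
-- so that it can be any finite set of symbols and not just an initial segment.
-- The morphisms φ and τ are given by their values on letters.
record LSystem : Set where
  field
    σ                : ℕ
    symbol           : Fin σ → ℕ
    symbol-injective : Injective _≡_ _≡_ symbol
    φ                : Fin σ → List⁺ (Fin σ)
    τ                : Fin σ → Fin σ
    s                : List⁺ (Fin σ)
    d                : ℕ
    n                : ℕ
    1≤n              : 1 ≤ n

  φ* : List (Fin σ) → List (Fin σ)
  φ* = concatMap (λ a → List⁺.toList (φ a))

  τ* : List (Fin σ) → List (Fin σ)
  τ* = map τ

  -- τ(φᵈ(s))
  word : List (Fin σ)
  word = τ* (fold (List⁺.toList s) φ* d)

  size : ℕ
  size = sum (map (λ a → List⁺.length (φ a)) (allFin σ)) + List⁺.length s + σ + 2

  -- The first condition says that the prefix word[1 : n] exists.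
  Generates : String → Set
  Generates w = n ≤ length word × map symbol (take n word) ≡ w

  -- The standing assumption d, |Σ| = n^O(1), with explicit exponent.
  PolyBounded : ℕ → Set
  PolyBounded k = d ≤ n ^ k × σ ≤ n ^ k

-- ℓ[ k ] w ≔ m : the smallest size of an L-system generating w, among those
-- with d, |Σ| ≤ nᵏ, is m.
ℓ[_]_≔_ : ℕ → String → ℕ → Set
ℓ[ k ] w ≔ m =
  (Σ[ L ∈ LSystem ] LSystem.PolyBounded L k × LSystem.Generates L w × LSystem.size L ≡ m) ×
  (∀ (L : LSystem) → LSystem.PolyBounded L k → LSystem.Generates L w → m ≤ LSystem.size L)

------------------------------------------------------------------------
-- String families and asymptotics

-- Having members of unbounded length entails being infinite.
StringFamily : Pred String 0ℓ → Set
StringFamily F = ∀ N → ∃[ w ] w ∈ F × N ≤ length w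

-- ℓ(w) = Ω(r(w) log n / log log n) for w ∈ F, where n = |w|. The implied
-- constant is 1/C and the inequality is cleared of denominators; rounding the
-- logarithms down to integers changes them by at most a factor of 2 once n ≥ 4.
-- The exponent k of the standing assumption on L-systems is arbitrary but fixed
-- along the family.
ℓ=Ω[r·log/loglog] : Pred String 0ℓ → Set
ℓ=Ω[r·log/loglog] F =
  ∀ k → ∃[ C ] ∃[ n₀ ] ∀ w → w ∈ F → n₀ ≤ length w →
  ∀ m → ℓ[ k ] w ≔ m →
  let n = length w in
  r w * ⌊log₂ n ⌋ ≤ C * (m * ⌊log₂ ⌊log₂ n ⌋ ⌋)

{-# OPTIONS --safe #-}
-- A binary word w with R ones satisfies r(w) ≤ 1 + 2R, because BWT(w) is a
-- rearrangement of w.  There are at least N^R such words of length R·N, whereas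
-- an L-system of size ≤ S generating a binary word of known length is determined
-- by d and by a string of length 2S over B > S letters.  With R = log N the
-- factor nᵏ coming from d ≤ nᵏ is negligible (for fixed k) against N^R, so by
-- counting some word needs S log S ≳ R log N, where log S ≈ log log n.
module Submission where

open import Defs
open import Data.Fin.Base using (Fin; zero; suc; toℕ)
open import Data.Fin.Properties using (toℕ<n; injective⇒≤)
open import Data.List.Base
  using (List; []; _∷_; _++_; _∷ʳ_; _∷ʳ′_; initLast; allFin; applyUpTo; cartesianProductWith; catMaybes;
         concatMap; drop; foldr; head; last; length; lookup; map; mapMaybe; replicate; tabulate; take; upTo)
open import Data.List.Membership.Propositional using (find) renaming (_∈_ to _∈ˡ_)
import Data.List.Membership.DecPropositional as DecMembership
open import Data.List.Membership.Propositional.Properties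
  using (∈-cartesianProductWith⁺; ∈-cartesianProductWith⁻; ∈-upTo⁺; ∈-upTo⁻; ∈-lookup)
import Data.List.Membership.Setoid.Properties as SetoidMembership
open import Data.List.NonEmpty.Base as List⁺ using (List⁺)
open import Data.List.Properties hiding (sum-++)
open import Data.List.Relation.Binary.Permutation.Propositional
  using (_↭_; ↭-refl; ↭-trans; ↭-reflexive)
open import Data.List.Relation.Binary.Permutation.Propositional.Properties using (mapMaybe-↭; ∷↭∷ʳ)
open import Data.List.Relation.Unary.All as All using (All; []; _∷_)
import Data.List.Relation.Unary.All.Properties as All
open import Data.List.Relation.Unary.Any as Any using (here)
open import Data.List.Relation.Unary.AllPairs using ([]; _∷_)
open import Data.List.Relation.Unary.Unique.Propositional using (Unique)
import Data.List.Relation.Unary.Unique.Propositional.Properties as Unique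
open import Data.List.Sort.Base using (module SortingAlgorithm)
open import Data.List.Sort.MergeSort using (mergeSort)
open import Data.Maybe.Base using (just; fromMaybe)
open import Data.Nat.Base
open import Data.Nat.DivMod using (_/_; _%_; m/n*n≤m; m/n<m; m≡m%n+[m/n]*n; m%n<n)
open import Data.Nat.GeneralisedArithmetic using (fold)
open import Data.Nat.ListAction using (sum)
open import Data.Nat.ListAction.Properties using (sum-++; sum-↭)
open import Data.Nat.Logarithm using (⌊log₂_⌋; ⌊log₂⌋-mono-≤; ⌊log₂[2^n]⌋≡n)
open import Data.Nat.Properties
open import Data.Nat.Tactic.RingSolver using (solve-∀)
open import Data.Product.Base using (∃-syntax; _×_; _,_; proj₁; proj₂)
open import Function.Base using (_∘_; id)
open import Relation.Binary.PropositionalEquality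
open import Relation.Nullary using (¬_; Dec; yes; no; contradiction)

-- The Burrows-Wheeler transform as a rearrangement, and its number of runs

last-∷ʳ : ∀ {A : Set} (xs : List A) x → last (xs ∷ʳ x) ≡ just x
last-∷ʳ []           x = refl
last-∷ʳ (_ ∷ [])     x = refl
last-∷ʳ (_ ∷ y ∷ xs) x = last-∷ʳ (y ∷ xs) x

-- The list number `i` ends with the symbol of `xs` at index `i`, whatever precedes it. The prefixes
-- `as` are arbitrary so that the induction can move the head of `xs` into them.
catMaybes-last-take : ∀ {A : Set} (as : ℕ → List A) xs ys →
  catMaybes (applyUpTo (λ i → last (as i ++ take (suc i) (xs ++ ys))) (length xs)) ≡ xs
catMaybes-last-take as []       ys = refl
catMaybes-last-take as (x ∷ xs) ys rewrite last-∷ʳ (as 0) x = cong (x ∷_) (begin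
  catMaybes (applyUpTo (λ i → last (as (suc i) ++ x ∷ take (suc i) (xs ++ ys))) (length xs))
    ≡⟨ cong catMaybes (applyUpTo-cong (λ i → cong last (sym (∷ʳ-++ (as (suc i)) x _))) (length xs)) ⟩
  catMaybes (applyUpTo (λ i → last ((as (suc i) ∷ʳ x) ++ take (suc i) (xs ++ ys))) (length xs))
    ≡⟨ catMaybes-last-take (λ i → as (suc i) ∷ʳ x) xs ys ⟩
  xs ∎)
  where
  open ≡-Reasoning
  applyUpTo-cong : ∀ {A : Set} {f g : ℕ → A} → f ≗ g → ∀ n → applyUpTo f n ≡ applyUpTo g n
  applyUpTo-cong {f = f} {g} f≗g n =
    trans (sym (map-upTo f n)) (trans (map-cong f≗g (upTo n)) (map-upTo g n))

rotation : String → ℕ → String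
rotation w i = drop i w ++ take i w

-- Rotation 0 ends with the last symbol of `w`, and each later rotation `i` ends with the `i`-th
-- symbol of `w`. The column is thus `w` with its last symbol moved to the front.
lastColumn : ∀ w → mapMaybe last (rotations w) ↭ w
lastColumn w with initLast w
... | []       = ↭-refl
... | xs ∷ʳ′ x = ↭-trans (↭-reflexive eq) (∷↭∷ʳ x xs)
  where
  v = xs ∷ʳ x
  open ≡-Reasoning
  eq : mapMaybe last (rotations v) ≡ x ∷ xs
  eq = begin
    catMaybes (map last (map (rotation v) (upTo (length v))))
      ≡⟨ cong (catMaybes ∘ map last) (map-upTo (rotation v) (length v)) ⟩
    catMaybes (map last (applyUpTo (rotation v) (length v)))
      ≡⟨ cong catMaybes (map-applyUpTo (rotation v) last (length v)) ⟩
    catMaybes (applyUpTo (last ∘ rotation v) (length v))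
      -- Swapping the summands of the length exposes a successor, which splits off rotation 0.
      ≡⟨ cong (λ n → catMaybes (applyUpTo (last ∘ rotation v) n)) (length-++-comm xs (x ∷ [])) ⟩
    catMaybes (last (v ++ []) ∷ columns)
      ≡⟨ cong (λ z → catMaybes (z ∷ columns)) (trans (cong last (++-identityʳ v)) (last-∷ʳ xs x)) ⟩
    x ∷ catMaybes columns
      ≡⟨ cong (x ∷_) (catMaybes-last-take (λ i → drop (suc i) v) xs (x ∷ [])) ⟩
    x ∷ xs ∎
    where columns = applyUpTo (last ∘ rotation v ∘ suc) (length xs)

BWT-↭ : ∀ w → BWT w ↭ w
BWT-↭ w = ↭-trans (mapMaybe-↭ last (sort-↭ (rotations w))) (lastColumn w)
  where open SortingAlgorithm (mergeSort lexOrder)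

-- The clipped first symbol makes the induction work: a nonzero symbol opens at
-- most its own run and a run of zeros after it.
runs-∷ : ∀ x w → runs (x ∷ w) ≤ 1 + x ⊓ 1 + 2 * sum w
runs-∷ x []      = s≤s z≤n
runs-∷ x (y ∷ w) = step x y (x ≟ y) (runs-∷ y w)
  where
  open ≤-Reasoning
  step : ∀ x y → Dec (x ≡ y) → runs (y ∷ w) ≤ 1 + y ⊓ 1 + 2 * sum w →
         runs (x ∷ y ∷ w) ≤ 1 + x ⊓ 1 + 2 * sum (y ∷ w)
  step x .x (yes refl) ih = begin
    runs (x ∷ x ∷ w)             ≡⟨ cong length (derun-reject _≟_ w refl) ⟩
    runs (x ∷ w)                 ≤⟨ ih ⟩
    1 + x ⊓ 1 + 2 * sum w        ≤⟨ +-monoʳ-≤ (1 + x ⊓ 1) (*-monoʳ-≤ 2 (m≤n+m (sum w) x)) ⟩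
    1 + x ⊓ 1 + 2 * sum (x ∷ w)  ∎
  step zero    zero    (no x≢y) ih = contradiction refl x≢y
  step (suc x) zero    (no x≢y) ih = begin
    runs (suc x ∷ 0 ∷ w)  ≡⟨ cong length (derun-accept _≟_ w x≢y) ⟩
    suc (runs (0 ∷ w))    ≤⟨ s≤s ih ⟩
    2 + 2 * sum w         ≡⟨ cong (λ z → suc z + 2 * sum w) (m≥n⇒m⊓n≡n {suc x} (s≤s z≤n)) ⟨
    1 + suc x ⊓ 1 + 2 * sum w ∎
  step x       (suc y) (no x≢y) ih = begin
    runs (x ∷ suc y ∷ w)               ≡⟨ cong length (derun-accept _≟_ w x≢y) ⟩
    suc (runs (suc y ∷ w))             ≤⟨ s≤s ih ⟩
    suc (1 + suc y ⊓ 1 + 2 * sum w)    ≤⟨ s≤s (+-monoˡ-≤ (2 * sum w) (s≤s (m⊓n≤n (suc y) 1))) ⟩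
    1 + (2 + 2 * sum w)                ≡⟨ cong suc (*-suc 2 (sum w)) ⟨
    1 + 2 * suc (sum w)                ≤⟨ s≤s (*-monoʳ-≤ 2 (s≤s (m≤n+m (sum w) y))) ⟩
    1 + 2 * sum (suc y ∷ w)            ≤⟨ s≤s (m≤n+m _ (x ⊓ 1)) ⟩
    1 + x ⊓ 1 + 2 * sum (suc y ∷ w)    ∎

runs≤1+2*sum : ∀ w → runs w ≤ 1 + 2 * sum w
runs≤1+2*sum []      = z≤n
runs≤1+2*sum (x ∷ w) = begin
  runs (x ∷ w)            ≤⟨ runs-∷ x w ⟩
  1 + x ⊓ 1 + 2 * sum w   ≤⟨ s≤s (+-monoˡ-≤ (2 * sum w) (≤-trans (m⊓n≤m x 1) (m≤n*m x 2))) ⟩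
  1 + (2 * x + 2 * sum w) ≡⟨ cong suc (*-distribˡ-+ 2 x (sum w)) ⟨
  1 + 2 * sum (x ∷ w)     ∎
  where open ≤-Reasoning

-- The sum is invariant under rearrangement, so the bound passes from `BWT w` to `w`. On a binary
-- word the sum is the number of ones.
r≤1+2*sum : ∀ w → r w ≤ 1 + 2 * sum w
r≤1+2*sum w = subst (λ z → r w ≤ 1 + 2 * z) (sum-↭ (BWT-↭ w)) (runs≤1+2*sum (BWT w))

-- Sparse words

blocks : List ℕ → String
blocks []       = []
blocks (e ∷ es) = replicate e 0 ++ 1 ∷ blocks es

-- The padding gives all words one length without adding ones, provided that the blocks fit into
-- `n`.
sparseWord : ℕ → List ℕ → String
sparseWord n es = blocks es ++ replicate (n ∸ length (blocks es)) 0

-- The counter `c` holds the zeros read since the last nonzero symbol. Zeros at the end are dropped,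
-- which makes the padding invisible.
gapsFrom : ℕ → String → List ℕ
gapsFrom c []          = []
gapsFrom c (zero  ∷ w) = gapsFrom (suc c) w
gapsFrom c (suc _ ∷ w) = c ∷ gapsFrom 0 w

gapsFrom-zeros : ∀ c e w → gapsFrom c (replicate e 0 ++ w) ≡ gapsFrom (c + e) w
gapsFrom-zeros c zero    w = cong (λ c → gapsFrom c w) (sym (+-identityʳ c))
gapsFrom-zeros c (suc e) w =
  trans (gapsFrom-zeros (suc c) e w) (cong (λ c → gapsFrom c w) (sym (+-suc c e)))

gaps-blocks : ∀ es p → gapsFrom 0 (blocks es ++ replicate p 0) ≡ es
gaps-blocks []       p = trans (cong (gapsFrom 0) (sym (++-identityʳ (replicate p 0)))) (gapsFrom-zeros 0 p [])
gaps-blocks (e ∷ es) p = begin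
  gapsFrom 0 ((replicate e 0 ++ 1 ∷ blocks es) ++ replicate p 0)
    ≡⟨ cong (gapsFrom 0) (++-assoc (replicate e 0) (1 ∷ blocks es) (replicate p 0)) ⟩
  gapsFrom 0 (replicate e 0 ++ 1 ∷ blocks es ++ replicate p 0)
    ≡⟨ gapsFrom-zeros 0 e _ ⟩
  e ∷ gapsFrom 0 (blocks es ++ replicate p 0)
    ≡⟨ cong (e ∷_) (gaps-blocks es p) ⟩
  e ∷ es ∎
  where open ≡-Reasoning

-- This left inverse shows that distinct gap lists give distinct words.
gaps-sparseWord : ∀ n es → gapsFrom 0 (sparseWord n es) ≡ es
gaps-sparseWord n es = gaps-blocks es _

length-blocks : ∀ {N} es → All (_< N) es → length (blocks es) ≤ length es * N
length-blocks         []       []           = z≤n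
length-blocks {N = N} (e ∷ es) (e<N ∷ es<N) = begin
  length (replicate e 0 ++ 1 ∷ blocks es)       ≡⟨ length-++ (replicate e 0) ⟩
  length (replicate e 0) + suc (length (blocks es))
    ≡⟨ cong (_+ suc (length (blocks es))) (length-replicate e) ⟩
  e + suc (length (blocks es))                  ≡⟨ +-suc e _ ⟩
  suc e + length (blocks es)                    ≤⟨ +-mono-≤ e<N (length-blocks es es<N) ⟩
  N + length es * N                             ∎
  where open ≤-Reasoning

length-sparseWord : ∀ {n} es → length (blocks es) ≤ n → length (sparseWord n es) ≡ n
length-sparseWord {n} es ≤n = begin
  length (sparseWord n es)                              ≡⟨ length-++ (blocks es) ⟩
  length (blocks es) + length (replicate (n ∸ length (blocks es)) 0)
    ≡⟨ cong (length (blocks es) +_) (length-replicate (n ∸ length (blocks es))) ⟩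
  length (blocks es) + (n ∸ length (blocks es))         ≡⟨ m+[n∸m]≡n ≤n ⟩
  n                                                     ∎
  where open ≡-Reasoning

sum-replicate-0 : ∀ p → sum (replicate p 0) ≡ 0
sum-replicate-0 zero    = refl
sum-replicate-0 (suc p) = sum-replicate-0 p

sum-blocks : ∀ es → sum (blocks es) ≡ length es
sum-blocks []       = refl
sum-blocks (e ∷ es) = trans (sum-++ (replicate e 0) (1 ∷ blocks es))
  (cong₂ _+_ (sum-replicate-0 e) (cong suc (sum-blocks es)))

sum-sparseWord : ∀ n es → sum (sparseWord n es) ≡ length es
sum-sparseWord n es = trans (sum-++ (blocks es) _)
  (trans (cong₂ _+_ (sum-blocks es) (sum-replicate-0 (n ∸ length (blocks es)))) (+-identityʳ _))

blocks-binary : ∀ es → All (_≤ 1) (blocks es)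
blocks-binary []       = []
blocks-binary (e ∷ es) = All.++⁺ (All.replicate⁺ e z≤n) (≤-refl ∷ blocks-binary es)

sparseWord-binary : ∀ n es → All (_≤ 1) (sparseWord n es)
sparseWord-binary n es = All.++⁺ (blocks-binary es) (All.replicate⁺ _ z≤n)

-- Counting lists

lists : ℕ → ℕ → List (List ℕ)
lists B zero    = [] ∷ []
lists B (suc m) = cartesianProductWith _∷_ (upTo B) (lists B m)

length-cartesianProductWith : ∀ {A B C : Set} (f : A → B → C) xs ys →
  length (cartesianProductWith f xs ys) ≡ length xs * length ys
length-cartesianProductWith f []       ys = refl
length-cartesianProductWith f (x ∷ xs) ys = trans (length-++ (map (f x) ys))
  (cong₂ _+_ (length-map (f x) ys) (length-cartesianProductWith f xs ys))

length-lists : ∀ B m → length (lists B m) ≡ B ^ m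
length-lists B zero    = refl
length-lists B (suc m) = trans (length-cartesianProductWith _∷_ (upTo B) (lists B m))
  (cong₂ _*_ (length-upTo B) (length-lists B m))

lists-Unique : ∀ B m → Unique (lists B m)
lists-Unique B zero    = [] ∷ []
lists-Unique B (suc m) =
  Unique.cartesianProductWith⁺ _∷_ ∷-injective (Unique.upTo⁺ B) (lists-Unique B m)

∈-lists⁺ : ∀ {B xs} → All (_< B) xs → xs ∈ˡ lists B (length xs)
∈-lists⁺ []           = here refl
∈-lists⁺ (x<B ∷ xs<B) = ∈-cartesianProductWith⁺ _∷_ (∈-upTo⁺ x<B) (∈-lists⁺ xs<B)

∈-lists⁻ : ∀ {B} m {xs} → xs ∈ˡ lists B m → length xs ≡ m × All (_< B) xs
∈-lists⁻     zero    (here refl) = refl , []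
∈-lists⁻ {B} (suc m) xs∈
  with _ , _ , x∈ , ys∈ , refl ← ∈-cartesianProductWith⁻ _∷_ (upTo B) (lists B m) xs∈
  with eq , ys<B ← ∈-lists⁻ m ys∈ = cong suc eq , ∈-upTo⁻ x∈ ∷ ys<B

lookup-injective : ∀ {A : Set} {xs : List A} → Unique xs → ∀ i j → lookup xs i ≡ lookup xs j → i ≡ j
lookup-injective (_ ∷ _)    zero    zero    _  = refl
lookup-injective (x∉ ∷ _)   zero    (suc j) eq = contradiction eq (All.lookup x∉ (∈-lookup j))
lookup-injective (x∉ ∷ _)   (suc i) zero    eq = contradiction (sym eq) (All.lookup x∉ (∈-lookup i))
lookup-injective (_ ∷ xs!)  (suc i) (suc j) eq = cong suc (lookup-injective xs! i j eq)

-- Pigeonhole principle: sending a position of `xs` to the index of its entry in `ys` is injective.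
Unique⇒length≤ : ∀ {A : Set} {xs ys : List A} → Unique xs → All (_∈ˡ ys) xs → length xs ≤ length ys
Unique⇒length≤ {A} {xs} {ys} xs! xs⊆ys = injective⇒≤ {f = λ i → Any.index (∈ys i)} λ {i} {j} eq →
  lookup-injective xs! i j (SetoidMembership.index-injective (setoid A) (∈ys i) (∈ys j) eq)
  where
  ∈ys : ∀ i → lookup xs i ∈ˡ ys
  ∈ys i = All.lookup xs⊆ys (∈-lookup i)

-- Codes of L-systems

-- Letters are shifted by one, so that 0 can end a segment.
terminated : List ℕ → List ℕ → List ℕ
terminated xs c = map suc xs ++ 0 ∷ c

segment : ℕ → List ℕ → List ℕ
segment _       []          = []
segment zero    (zero  ∷ c) = []
segment zero    (suc x ∷ c) = x ∷ segment zero c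
segment (suc k) (zero  ∷ c) = segment k c
segment (suc k) (suc x ∷ c) = segment (suc k) c

segment-zero : ∀ xs c → segment 0 (terminated xs c) ≡ xs
segment-zero []       c = refl
segment-zero (x ∷ xs) c = cong (x ∷_) (segment-zero xs c)

segment-suc : ∀ k xs c → segment (suc k) (terminated xs c) ≡ segment k c
segment-suc k []       c = refl
segment-suc k (x ∷ xs) c = segment-suc k xs c

-- The tail `c` is arbitrary, so padding after the last segment does not disturb decoding.
segment-tabulate : ∀ {n} (f : Fin n → List ℕ) c i →
  segment (toℕ i) (foldr terminated c (tabulate f)) ≡ f i
segment-tabulate f c zero    = segment-zero (f zero) _
segment-tabulate f c (suc i) =
  trans (segment-suc (toℕ i) (f zero) _) (segment-tabulate (f ∘ suc) c i)

length-terminated : ∀ xs c → length (terminated xs c) ≡ length xs + suc (length c)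
length-terminated xs c = trans (length-++ (map suc xs)) (cong (_+ suc (length c)) (length-map suc xs))

All-terminated : ∀ {B xs c} → All (λ x → suc x < B) xs → All (_< B) c → 0 < B → All (_< B) (terminated xs c)
All-terminated xs<B c<B 0<B = All.++⁺ (All.map⁺ xs<B) (0<B ∷ c<B)

-- Segment 0 of a code is the axiom, and segment 1 + a consists of the symbol
-- output for the letter a followed by φ(a).
decode : ℕ → List ℕ → ℕ → String
decode n c d = map output (take n (fold (segment 0 c) (concatMap rhs) d))
  module Decode where
  output : ℕ → ℕ
  -- The default makes `decode` total on all lists; in the code of an L-system every rule segment
  -- starts with an output symbol.
  output a = fromMaybe 0 (head (segment (suc a) c))
  rhs : ℕ → List ℕ
  rhs a = drop 1 (segment (suc a) c)

length-generated : ∀ L {w} → LSystem.Generates L w → length w ≡ LSystem.n L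
length-generated L (n≤ , refl) =
  trans (length-map symbol (take n word)) (trans (length-take n word) (m≤n⇒m⊓n≡m n≤))
  where open LSystem L

module Code (L : LSystem) where
  open LSystem L

  -- Clipping to {0,1} loses nothing when the generated word is binary.
  output : Fin σ → ℕ
  output a = symbol (τ a) ⊓ 1

  rule : Fin σ → List ℕ
  rule a = output a ∷ map toℕ (List⁺.toList (φ a))

  axiom : List ℕ
  axiom = map toℕ (List⁺.toList s)

  -- The `p` zeros at the end only add empty segments; they bring codes of different systems to a
  -- common length.
  code : ℕ → List ℕ
  code p = terminated axiom (foldr terminated (replicate p 0) (tabulate rule))

  segment-code : ∀ p a → segment (suc (toℕ a)) (code p) ≡ rule a
  segment-code p a = trans (segment-suc (toℕ a) axiom _) (segment-tabulate rule _ a)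

  -- Decoding retraces the derivation: the segment of a letter `a` returns `φ a`, so `toℕ` commutes
  -- with each rewriting step.
  derivation-code : ∀ p d → fold (segment 0 (code p)) (concatMap (Decode.rhs n (code p) d)) d
                          ≡ map toℕ (fold (List⁺.toList s) φ* d)
  derivation-code p zero    = segment-zero axiom _
  derivation-code p (suc d) = begin
    concatMap (Decode.rhs n (code p) d) (fold (segment 0 (code p)) (concatMap (Decode.rhs n (code p) d)) d)
      ≡⟨ cong (concatMap (Decode.rhs n (code p) d)) (derivation-code p d) ⟩
    concatMap (Decode.rhs n (code p) d) (map toℕ X)
      ≡⟨ concatMap-map _ toℕ X ⟩
    concatMap (λ a → Decode.rhs n (code p) d (toℕ a)) X
      ≡⟨ concatMap-cong (λ a → cong (drop 1) (segment-code p a)) X ⟩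
    concatMap (λ a → map toℕ (List⁺.toList (φ a))) X
      ≡⟨ map-concatMap toℕ _ X ⟨
    map toℕ (φ* X) ∎
    where
    open ≡-Reasoning
    X = fold (List⁺.toList s) φ* d

  decode-code : ∀ {w} p → All (_≤ 1) w → Generates w → decode (length w) (code p) d ≡ w
  decode-code {w} p w≤1 (n≤ , refl) = begin
    decode (length w) (code p) d
      ≡⟨ cong (λ n → decode n (code p) d) (length-generated L (n≤ , refl)) ⟩
    map (Decode.output n (code p) d) (take n (fold (segment 0 (code p)) (concatMap (Decode.rhs n (code p) d)) d))
      ≡⟨ cong (λ x → map (Decode.output n (code p) d) (take n x)) (derivation-code p d) ⟩
    map (Decode.output n (code p) d) (take n (map toℕ X))
      ≡⟨ cong (map _) (take-map n X) ⟩
    map (Decode.output n (code p) d) (map toℕ (take n X))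
      ≡⟨ map-∘ (take n X) ⟨
    map (λ a → Decode.output n (code p) d (toℕ a)) (take n X)
      ≡⟨ map-cong (λ a → cong (λ l → fromMaybe 0 (head l)) (segment-code p a)) (take n X) ⟩
    map output (take n X)
      ≡⟨ map-∘ (take n X) ⟩
    map (λ a → symbol a ⊓ 1) (map τ (take n X))
      ≡⟨ map-∘ (map τ (take n X)) ⟩
    map (_⊓ 1) (map symbol (map τ (take n X)))
      ≡⟨ cong (map (_⊓ 1) ∘ map symbol) (take-map n X) ⟨
    map (_⊓ 1) (map symbol (take n word))
      -- The outputs were clipped to at most 1, which leaves a binary word unchanged.
      ≡⟨ map-id-local (All.map m≤n⇒m⊓n≡m w≤1) ⟩
    map symbol (take n word) ∎
    where
    open ≡-Reasoning
    X = fold (List⁺.toList s) φ* d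

  -- The factor 2 accounts for the output symbol and the terminating zero of each rule.
  length-rules : ∀ c as → length (foldr terminated c (map rule as))
                        ≡ 2 * length as + sum (map (λ a → List⁺.length (φ a)) as) + length c
  length-rules c []       = refl
  length-rules c (a ∷ as) = begin
    length (terminated (rule a) (foldr terminated c (map rule as)))
      ≡⟨ length-terminated (rule a) _ ⟩
    length (rule a) + suc (length (foldr terminated c (map rule as)))
      ≡⟨ cong₂ (λ x y → suc x + suc y) (length-map toℕ (List⁺.toList (φ a))) (length-rules c as) ⟩
    suc (List⁺.length (φ a)) + suc (2 * length as + ∑ + length c)
      ≡⟨ arith (List⁺.length (φ a)) (length as) ∑ (length c) ⟩
    2 * suc (length as) + (List⁺.length (φ a) + ∑) + length c ∎
    where
    open ≡-Reasoning
    ∑ = sum (map (λ a → List⁺.length (φ a)) as)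
    arith : ∀ x y z u → suc x + suc (2 * y + z + u) ≡ 2 * suc y + (x + z) + u
    arith = solve-∀

  ruleLengths : ℕ
  ruleLengths = sum (map (λ a → List⁺.length (φ a)) (allFin σ))

  unpaddedLength : ℕ
  unpaddedLength = List⁺.length s + suc (2 * σ + ruleLengths)

  length-code : ∀ p → length (code p) ≡ unpaddedLength + p
  length-code p = begin
    length (code p)
      ≡⟨ length-terminated axiom _ ⟩
    length axiom + suc (length (foldr terminated pad (tabulate rule)))
      ≡⟨ cong₂ (λ x y → x + suc y) (length-map toℕ (List⁺.toList s))
           (cong (length ∘ foldr terminated pad) (sym (map-tabulate id rule))) ⟩
    List⁺.length s + suc (length (foldr terminated pad (map rule (allFin σ))))
      ≡⟨ cong (λ x → List⁺.length s + suc x) (length-rules pad (allFin σ)) ⟩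
    List⁺.length s + suc (2 * length (allFin σ) + ruleLengths + length pad)
      ≡⟨ cong₂ (λ x y → List⁺.length s + suc (2 * x + ruleLengths + y)) (length-tabulate {n = σ} id) (length-replicate p) ⟩
    List⁺.length s + suc (2 * σ + ruleLengths + p)
      ≡⟨ +-assoc (List⁺.length s) (suc (2 * σ + ruleLengths)) p ⟨
    unpaddedLength + p ∎
    where
    open ≡-Reasoning
    pad = replicate p 0

  unpaddedLength≤2*size : unpaddedLength ≤ 2 * size
  -- The added term is the exact difference of the two sides.
  unpaddedLength≤2*size = ≤-trans (m≤m+n unpaddedLength (ruleLengths + List⁺.length s + 3))
    (≤-reflexive (arith (List⁺.length s) σ ruleLengths))
    where
    arith : ∀ x y z → x + suc (2 * y + z) + (z + x + 3) ≡ 2 * (z + x + y + 2)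
    arith = solve-∀

  σ≤size : σ ≤ size
  σ≤size = ≤-trans (m≤n+m σ _) (m≤m+n _ 2)

  -- A shifted letter is at most `σ`, hence at most `size`; a shifted output symbol is at most 2.
  code-bounded : ∀ {B} p → size < B → 2 < B → All (_< B) (code p)
  code-bounded {B} p size<B 2<B =
    All-terminated (letters (List⁺.toList s)) (rules id) 0<B
    where
    0<B : 0 < B
    0<B = ≤-<-trans z≤n 2<B
    letters : ∀ as → All (λ x → suc x < B) (map toℕ as)
    letters as = All.map⁺ (All.universal (λ a → ≤-<-trans (≤-trans (toℕ<n a) σ≤size) size<B) as)
    rules : ∀ {m} (f : Fin m → Fin σ) → All (_< B) (foldr terminated (replicate p 0) (tabulate (rule ∘ f)))
    rules {zero}  f = All.replicate⁺ p 0<B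
    rules {suc m} f = All-terminated
      (≤-<-trans (s≤s (m⊓n≤n _ 1)) 2<B ∷ letters (List⁺.toList (φ (f zero)))) (rules (f ∘ suc)) 0<B

-- Existence of incompressible sparse words

codes : ℕ → ℕ → List (List ℕ)
codes B S = lists B (2 * S)

-- Padding to length exactly `2 * S` places all systems of size at most `S` in one list of
-- `B ^ (2 * S)` codes.
∃-code : ∀ {B S} → S < B → 2 < B → ∀ L → LSystem.size L ≤ S →
  ∃[ c ] c ∈ˡ codes B S ×
         (∀ {w} → All (_≤ 1) w → LSystem.Generates L w → decode (length w) c (LSystem.d L) ≡ w)
∃-code {B} {S} S<B 2<B L size≤S =
  code p ,
  subst (λ m → code p ∈ˡ lists B m) length≡ (∈-lists⁺ (code-bounded p (≤-<-trans size≤S S<B) 2<B)) ,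
  decode-code p
  where
  open Code L
  p = 2 * S ∸ unpaddedLength
  length≡ : length (code p) ≡ 2 * S
  length≡ = trans (length-code p) (m+[n∸m]≡n (≤-trans unpaddedLength≤2*size (*-monoʳ-≤ 2 size≤S)))

-- A code together with some `d ≤ D` determines at most one word of length `R * N`, whereas the
-- `N ^ R` gap lists yield distinct words of that length.
∃-incompressible : ∀ N R S B D → S < B → 2 < B → B ^ (2 * S) * suc D < N ^ R →
  ∃[ w ] length w ≡ R * N × sum w ≡ R ×
         (∀ L → LSystem.d L ≤ D → LSystem.Generates L w → S < LSystem.size L)
∃-incompressible N R S B D S<B 2<B few =
  -- Membership is decidable, so a gap list that is not covered can be found by search.
  let es , es∈ , es∉       = find (All.¬All⇒Any¬ (_∈? compressible) (lists N R) ¬all-compressible)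
      length-es , es<N     = ∈-lists⁻ R es∈
      length-w = length-sparseWord es (subst (λ m → length (blocks es) ≤ m * N) length-es (length-blocks es es<N))
  in sparseWord (R * N) es , length-w , trans (sum-sparseWord (R * N) es) length-es ,
     λ L d≤D gen → ≰⇒> λ size≤S → es∉ (in-compressible es length-w L d≤D gen size≤S)
  where
  open DecMembership (≡-dec _≟_) using (_∈?_)
  compressible : List (List ℕ)
  -- Decoded words are turned back into gap lists, so that the pigeonhole principle applies directly
  -- to `lists N R`. The values 0 to `D` of `d` give the factor `suc D`.
  compressible = cartesianProductWith (λ c d → gapsFrom 0 (decode (R * N) c d)) (codes B S) (upTo (suc D))
  length-compressible : length compressible ≡ B ^ (2 * S) * suc D
  length-compressible = trans (length-cartesianProductWith _ (codes B S) (upTo (suc D)))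
    (cong₂ _*_ (length-lists B (2 * S)) (length-upTo (suc D)))
  ¬all-compressible : ¬ All (_∈ˡ compressible) (lists N R)
  ¬all-compressible all = <⇒≱ few (subst₂ _≤_ (length-lists N R) length-compressible
    (Unique⇒length≤ (lists-Unique N R) all))
  in-compressible : ∀ es → length (sparseWord (R * N) es) ≡ R * N → ∀ L → LSystem.d L ≤ D →
    LSystem.Generates L (sparseWord (R * N) es) → LSystem.size L ≤ S → es ∈ˡ compressible
  in-compressible es length-w L d≤D gen size≤S with c , c∈ , decode-c ← ∃-code S<B 2<B L size≤S =
    subst (_∈ˡ compressible)
      (trans (cong (gapsFrom 0) (trans (cong (λ n → decode n c (LSystem.d L)) (sym length-w))
                (decode-c (sparseWord-binary (R * N) es) gen)))
             (gaps-sparseWord (R * N) es))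
      (∈-cartesianProductWith⁺ (λ c d → gapsFrom 0 (decode (R * N) c d)) c∈ (∈-upTo⁺ (s≤s d≤D)))

-- Choice of parameters

-- The offset 6 ensures that 8t ≤ 2ᵗ.  The bound D on d is nᵗ, which exceeds nᵏ
-- eventually, whatever k is.
module Parameters (u : ℕ) where
  -- The length `R * N` is `2 ^ (t + R)` with `R = 2 ^ t`: its logarithm is of order `R` and its
  -- iterated logarithm of order `t`.
  t R N D : ℕ
  t = 6 + u
  R = 2 ^ t
  N = 2 ^ R
  D = (R * N) ^ t

  -- A code has `2 * S` letters of `2 * t` bits each, in total at most half of the `R * R` bits
  -- needed to tell `N ^ R` words apart.
  S : ℕ
  S = R * R / (8 * t)

  8t≤R : 8 * t ≤ R
  8t≤R = go u
    where
    go : ∀ u → 8 * (6 + u) ≤ 2 ^ (6 + u)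
    go zero    = m≤m+n 48 16
    go (suc u) = begin
      8 * (7 + u)         ≡⟨ *-suc 8 (6 + u) ⟩
      8 + 8 * (6 + u)     ≤⟨ +-mono-≤ {y = 2 ^ (6 + u)} (≤-trans (m≤m*n 8 (6 + u)) (go u)) (go u) ⟩
      2 ^ (6 + u) + 2 ^ (6 + u) ≡⟨ cong (2 ^ (6 + u) +_) (+-identityʳ _) ⟨
      2 ^ (7 + u)         ∎
      where open ≤-Reasoning

  48≤R : 48 ≤ R
  48≤R = ≤-trans (*-monoʳ-≤ 8 (m≤m+n 6 u)) 8t≤R

  t≤R : t ≤ R
  t≤R = ≤-trans (m≤n*m t 8) 8t≤R

  length≡2^ : R * N ≡ 2 ^ (t + R)
  length≡2^ = sym (^-distribˡ-+-* 2 t R)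

  instance
    R≢0 : NonZero R
    R≢0 = m^n≢0 2 t
    RR≢0 : NonZero (R * R)
    RR≢0 = m*n≢0 R R

  2<RR : 2 < R * R
  2<RR = ≤-trans (m≤m+n 3 45) (≤-trans 48≤R (m≤m*n R R))

  S<RR : S < R * R
  S<RR = m/n<m (R * R) (8 * t) (s≤s (s≤s z≤n))

  -- After multiplication by 4, the codes contribute at most `2 * (R * R)`, the bound `D` at most
  -- `R * R`, and the successor 4, which is less than the remaining `R * R`.
  exponents : t * (4 * S) + suc ((t + R) * t) < R * R
  exponents = *-cancelˡ-< 4 _ _ (begin-strict
    4 * (t * (4 * S) + suc ((t + R) * t))          ≡⟨ arith₁ t S R ⟩
    4 + (2 * (S * (8 * t)) + 4 * ((t + R) * t))
      ≤⟨ +-monoʳ-≤ 4 (+-mono-≤ (*-monoʳ-≤ 2 (m/n*n≤m (R * R) (8 * t))) Y) ⟩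
    4 + (2 * (R * R) + R * R)
      <⟨ +-monoˡ-< (2 * (R * R) + R * R) (≤-trans (m≤m+n 5 43) (≤-trans 48≤R (m≤m*n R R))) ⟩
    R * R + (2 * (R * R) + R * R)         ≡⟨ arith₂ (R * R) ⟩
    4 * (R * R)                           ∎)
    where
    open ≤-Reasoning
    arith₁ : ∀ t S R → 4 * (t * (4 * S) + suc ((t + R) * t)) ≡ 4 + (2 * (S * (8 * t)) + 4 * ((t + R) * t))
    arith₁ = solve-∀
    arith₂ : ∀ x → x + (2 * x + x) ≡ 4 * x
    arith₂ = solve-∀
    arith₃ : ∀ t R → 4 * ((R + R) * t) ≡ R * (8 * t)
    arith₃ = solve-∀
    Y : 4 * ((t + R) * t) ≤ R * R
    Y = begin
      4 * ((t + R) * t) ≤⟨ *-monoʳ-≤ 4 (*-monoˡ-≤ t (+-monoˡ-≤ R t≤R)) ⟩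
      4 * ((R + R) * t) ≡⟨ arith₃ t R ⟩
      R * (8 * t)       ≤⟨ *-monoʳ-≤ R 8t≤R ⟩
      R * R             ∎

  few-codes : (R * R) ^ (2 * S) * suc D < N ^ R
  few-codes = begin-strict
    (R * R) ^ (2 * S) * suc D
      ≡⟨ cong₂ (λ x y → x ^ (2 * S) * suc (y ^ t)) (sym (^-distribˡ-+-* 2 t t)) length≡2^ ⟩
    (2 ^ (t + t)) ^ (2 * S) * suc ((2 ^ (t + R)) ^ t)
      ≡⟨ cong₂ (λ x y → x * suc y) (^-*-assoc 2 (t + t) (2 * S)) (^-*-assoc 2 (t + R) t) ⟩
    2 ^ ((t + t) * (2 * S)) * suc (2 ^ ((t + R) * t))
      -- The successor is absorbed by doubling the power of two, at the cost of 1 in the exponent.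
      ≤⟨ *-monoʳ-≤ (2 ^ ((t + t) * (2 * S))) (^-monoʳ-< 2 (s≤s (s≤s z≤n)) (n<1+n ((t + R) * t))) ⟩
    2 ^ ((t + t) * (2 * S)) * 2 ^ suc ((t + R) * t) ≡⟨ ^-distribˡ-+-* 2 ((t + t) * (2 * S)) _ ⟨
    2 ^ ((t + t) * (2 * S) + suc ((t + R) * t))
      ≡⟨ cong (λ x → 2 ^ (x + suc ((t + R) * t))) (arith t S) ⟩
    2 ^ (t * (4 * S) + suc ((t + R) * t)) <⟨ ^-monoʳ-< 2 (s≤s (s≤s z≤n)) exponents ⟩
    2 ^ (R * R)  ≡⟨ ^-*-assoc 2 R R ⟨
    N ^ R ∎
    where
    open ≤-Reasoning
    arith : ∀ t S → (t + t) * (2 * S) ≡ t * (4 * S)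
    arith = solve-∀

  hard : ∃[ w ] length w ≡ R * N × sum w ≡ R ×
                (∀ L → LSystem.d L ≤ D → LSystem.Generates L w → S < LSystem.size L)
  hard = ∃-incompressible N R S (R * R) D S<RR 2<RR few-codes

  hardWord : String
  hardWord = proj₁ hard

  length-hardWord : length hardWord ≡ 2 ^ (t + R)
  length-hardWord = trans (proj₁ (proj₂ hard)) length≡2^

  r-hardWord : r hardWord ≤ 1 + 2 * R
  r-hardWord = subst (λ z → r hardWord ≤ 1 + 2 * z) (proj₁ (proj₂ (proj₂ hard))) (r≤1+2*sum hardWord)

  -- Rounding down in `S` costs nothing: the size is at least `suc S`, and the remainder is below
  -- the divisor `8 * t`.
  size-hardWord : ∀ L → LSystem.d L ≤ D → LSystem.Generates L hardWord → R * R ≤ 8 * (LSystem.size L * t)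
  size-hardWord L d≤D gen = begin
    R * R                                   ≡⟨ m≡m%n+[m/n]*n (R * R) (8 * t) ⟩
    (R * R) % (8 * t) + S * (8 * t)
      ≤⟨ +-monoˡ-≤ (S * (8 * t)) (<⇒≤ (m%n<n (R * R) (8 * t))) ⟩
    suc S * (8 * t)
      ≤⟨ *-monoˡ-≤ (8 * t) (proj₂ (proj₂ (proj₂ hard)) L d≤D gen) ⟩
    LSystem.size L * (8 * t)                ≡⟨ arith (LSystem.size L) t ⟩
    8 * (LSystem.size L * t)                ∎
    where
    open ≤-Reasoning
    arith : ∀ m t → m * (8 * t) ≡ 8 * (m * t)
    arith = solve-∀

  t≤loglog : t ≤ ⌊log₂ ⌊log₂ length hardWord ⌋ ⌋
  t≤loglog = begin
    t                                 ≡⟨ ⌊log₂[2^n]⌋≡n t ⟨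
    ⌊log₂ R ⌋                         ≤⟨ ⌊log₂⌋-mono-≤ (m≤n+m R t) ⟩
    ⌊log₂ t + R ⌋
      ≡⟨ cong ⌊log₂_⌋ (trans (cong ⌊log₂_⌋ length-hardWord) (⌊log₂[2^n]⌋≡n (t + R))) ⟨
    ⌊log₂ ⌊log₂ length hardWord ⌋ ⌋   ∎
    where open ≤-Reasoning

  log-hardWord : ⌊log₂ length hardWord ⌋ ≤ 2 * R
  log-hardWord = begin
    ⌊log₂ length hardWord ⌋ ≡⟨ trans (cong ⌊log₂_⌋ length-hardWord) (⌊log₂[2^n]⌋≡n (t + R)) ⟩
    t + R                   ≤⟨ +-mono-≤ t≤R (m≤m+n R 0) ⟩
    2 * R                   ∎
    where open ≤-Reasoning

  -- The constant is `3 * 2 * 8`, from `r ≤ 3 * R`, `log n ≤ 2 * R` and `R * R ≤ 8 * (size * t)`.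
  r·log≤48·size·loglog : ∀ L → LSystem.d L ≤ D → LSystem.Generates L hardWord →
    r hardWord * ⌊log₂ length hardWord ⌋ ≤ 48 * (LSystem.size L * ⌊log₂ ⌊log₂ length hardWord ⌋ ⌋)
  r·log≤48·size·loglog L d≤D gen = begin
    r hardWord * ⌊log₂ length hardWord ⌋  ≤⟨ *-mono-≤ r-hardWord log-hardWord ⟩
    (1 + 2 * R) * (2 * R)                 ≤⟨ *-monoˡ-≤ (2 * R) (+-monoˡ-≤ (2 * R) (>-nonZero⁻¹ R)) ⟩
    (R + 2 * R) * (2 * R)                 ≡⟨ arith R ⟩
    6 * (R * R)                           ≤⟨ *-monoʳ-≤ 6 (size-hardWord L d≤D gen) ⟩
    6 * (8 * (LSystem.size L * t))        ≡⟨ *-assoc 6 8 (LSystem.size L * t) ⟨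
    48 * (LSystem.size L * t)             ≤⟨ *-monoʳ-≤ 48 (*-monoʳ-≤ (LSystem.size L) t≤loglog) ⟩
    48 * (LSystem.size L * ⌊log₂ ⌊log₂ length hardWord ⌋ ⌋) ∎
    where
    open ≤-Reasoning
    arith : ∀ R → (R + 2 * R) * (2 * R) ≡ 6 * (R * R)
    arith = solve-∀

-- The family of hard words

open Parameters using (hardWord)

n≤2^n : ∀ n → n ≤ 2 ^ n
n≤2^n zero    = z≤n
n≤2^n (suc n) = begin
  suc n          ≤⟨ +-mono-≤ (m^n>0 2 n) (n≤2^n n) ⟩
  2 ^ n + 2 ^ n  ≡⟨ cong (2 ^ n +_) (+-identityʳ (2 ^ n)) ⟨
  2 ^ suc n      ∎
  where open ≤-Reasoning

-- The length `2 ^ (t + 2 ^ t)` is strictly increasing in `t = 6 + u`, so a long word has a large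
-- parameter.
length-reflects-≤ : ∀ k u → 2 ^ (k + 2 ^ k) ≤ length (hardWord u) → k ≤ 6 + u
length-reflects-≤ k u n₀≤ = ≮⇒≥ λ t<k → <⇒≱
  (^-monoʳ-< 2 (s≤s (s≤s z≤n)) (+-mono-<-≤ t<k (^-monoʳ-≤ 2 (<⇒≤ t<k))))
  (≤-trans n₀≤ (≤-reflexive (Parameters.length-hardWord u)))

HardWords : String → Set
HardWords w = ∃[ u ] w ≡ hardWord u

HardWords-unbounded : StringFamily HardWords
HardWords-unbounded m = hardWord m , (m , refl) , (begin
  m                     ≤⟨ m≤n+m m 6 ⟩
  t                     ≤⟨ m≤m+n t R ⟩
  t + R                 ≤⟨ n≤2^n (t + R) ⟩
  2 ^ (t + R)           ≡⟨ length-hardWord ⟨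
  length (hardWord m)   ∎)
  where
  open ≤-Reasoning
  open Parameters m hiding (hardWord)

lemma4 : ∃[ F ] StringFamily F × ℓ=Ω[r·log/loglog] F
-- The threshold is the value of `2 ^ (t + 2 ^ t)` at `t = k`; from there on `n ^ k ≤ n ^ t = D`.
-- The constant 48 is the same for every `k`.
lemma4 = HardWords , HardWords-unbounded , λ k → 48 , 2 ^ (k + 2 ^ k) , bound k
  where
  bound : ∀ k w → HardWords w → 2 ^ (k + 2 ^ k) ≤ length w → ∀ m → ℓ[ k ] w ≔ m →
          r w * ⌊log₂ length w ⌋ ≤ 48 * (m * ⌊log₂ ⌊log₂ length w ⌋ ⌋)
  -- The minimum `m` is the size of some `L` generating the word, to which the lower bound applies.
  bound k _ (u , refl) n₀≤ _ ((L , (d≤ , _) , gen , refl) , _) =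
    Parameters.r·log≤48·size·loglog u L (≤-trans d≤ n^k≤D) gen
    where
    open Parameters u hiding (hardWord)
    n^k≤D : LSystem.n L ^ k ≤ D
    n^k≤D = begin
      LSystem.n L ^ k            ≡⟨ cong (_^ k) (length-generated L gen) ⟨
      length (hardWord u) ^ k    ≡⟨ cong (_^ k) length-hardWord ⟩
      (2 ^ (t + R)) ^ k
        ≤⟨ ^-monoʳ-≤ (2 ^ (t + R)) {{m^n≢0 2 (t + R)}} (length-reflects-≤ k u n₀≤) ⟩
      (2 ^ (t + R)) ^ t          ≡⟨ cong (_^ t) length≡2^ ⟨
      D                          ∎
      where open ≤-Reasoning
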